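{- Let $k=k(n)$ be a function of $n$ with $k(n)\to\infty$ as $n\to\infty$ and $k(n)=o(\sqrt{n})$. Then $g(n,K_3,S_{k(n)+1}) \ge (1+o(1))\dfrac{n\,k(n)^2}{48}$ as $n\to\infty$.
   Context: The Constructor-Blocker game with parameters $n$, a graph $H$ and a graph $F$: Constructor and Blocker alternately claim previously unclaimed edges of $K_n$, Constructor moving first. Constructor may only claim an edge if afterwards her graph (edges she has claimed) contains no subgraph isomorphic to $F$; Blocker may claim any unclaimed edge. The game ends when Constructor cannot claim any more edges or all edges are claimed. The score is the number of copies of $H$ in Constructor's final graph; Constructor maximizes, Blocker minimizes, and $g(n,H,F)$ is the score under optimal play. $K_3$ is the triangle and $S_m$ denotes the star with $m$ leaves (so being $S_{k+1}$-free means maximum degree at most $k$). -}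

module Defs where

open import Data.Nat using (ℕ; zero; suc; _<ᵇ_; _⊔_; _⊓_)
open import Data.Bool using (Bool; true; false; _∧_; _∨_; not)
open import Data.Fin using (Fin; toℕ)
open import Data.List using (List; []; _∷_; map; foldr; length; concatMap; allFin; filterᵇ)
open import Data.Bool.ListAction using (any)
open import Data.Product using (_×_; _,_; proj₁; proj₂)

-- Vertices of K_n are Fin n.  An edge is an ordered pair (i , j) with i < j,
-- representing the unordered edge {i , j}.
Edge : ℕ → Set
Edge n = Fin n × Fin n

_==_ : ∀ {n} → Fin n → Fin n → Bool
i == j = (toℕ i Data.Nat.≡ᵇ toℕ j)

_<<_ : ∀ {n} → Fin n → Fin n → Bool
i << j = toℕ i <ᵇ toℕ j

allEdges : (n : ℕ) → List (Edge n)
allEdges n = concatMap (λ i → map (λ j → (i , j)) (filterᵇ (λ j → i << j) (allFin n))) (allFin n)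

sameEdge : ∀ {n} → Edge n → Edge n → Bool
sameEdge (a , b) (c , d) = (a == c) ∧ (b == d)

_∈ᵇ_ : ∀ {n} → Edge n → List (Edge n) → Bool
e ∈ᵇ C = any (sameEdge e) C

adj : ∀ {n} → List (Edge n) → Fin n → Fin n → Bool
adj C u v = any (λ e → sameEdge (u , v) e ∨ sameEdge (v , u) e) C

-- degree of v in the graph with edge set C (C has no repeated edges in play)
deg : ∀ {n} → List (Edge n) → Fin n → ℕ
deg C v = length (filterᵇ (λ e → (proj₁ e == v) ∨ (proj₂ e == v)) C)

triangles : ∀ {n} → List (Edge n) → ℕ
triangles {n} C =
  length (concatMap (λ i → concatMap (λ j →
     filterᵇ (λ l → (i << j) ∧ (j << l) ∧ adj C i j ∧ adj C j l ∧ adj C i l) (allFin n))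
     (allFin n)) (allFin n))

unclaimed : ∀ {n} → List (Edge n) → List (Edge n) → List (Edge n)
unclaimed {n} C B = filterᵇ (λ e → not (e ∈ᵇ C ∨ e ∈ᵇ B)) (allEdges n)

-- Constructor may claim e iff afterwards her graph is S_{k+1}-free,
-- i.e. has maximum degree at most k; since only the endpoints of e change
-- degree, this means both endpoints currently have degree < k.
legalC : ∀ {n} → ℕ → List (Edge n) → Edge n → Bool
legalC k C (a , b) = (deg C a <ᵇ k) ∧ (deg C b <ᵇ k)

maxOver : ∀ {A : Set} → (A → ℕ) → List A → ℕ
maxOver f xs = foldr (λ x acc → f x ⊔ acc) 0 xs

minOver1 : ∀ {A : Set} → (A → ℕ) → A → List A → ℕ
minOver1 f x xs = foldr (λ y acc → f y ⊓ acc) (f x) xs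

-- Game values by minimax.  C = Constructor's edges, B = Blocker's edges.
-- The fuel argument bounds the number of remaining moves; it is started at
-- the total number of edges of K_n, so it never runs out before the game ends.
mutual
  valC : ∀ {n} → ℕ → ℕ → List (Edge n) → List (Edge n) → ℕ
  valC k zero C B = triangles C
  valC k (suc f) C B with filterᵇ (legalC k C) (unclaimed C B)
  ... | [] = triangles C
  ... | moves = maxOver (λ e → valB k f (e ∷ C) B) moves

  valB : ∀ {n} → ℕ → ℕ → List (Edge n) → List (Edge n) → ℕ
  valB k zero C B = triangles C
  valB k (suc f) C B with unclaimed C B
  ... | [] = triangles C
  ... | e ∷ es = minOver1 (λ e' → valC k f C (e' ∷ B)) e es

g-K3-star : (n k : ℕ) → ℕ
g-K3-star n k = valC {n} k (length (allEdges n)) [] []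

{-# OPTIONS --safe #-}
module Submission where

-- Cut the vertices into blocks of k consecutive ones and let G be the union of
-- the cliques on the blocks.  Give an edge weight 2, 1 or 0 according to whether
-- it is Constructor's, unclaimed or Blocker's, and let the potential Φ be the sum
-- over the triangles of G of the product of their edge weights.  Constructor
-- always claims an unclaimed edge of G with the largest partial derivative of Φ.
-- Blocker's reply f then costs at most what Constructor's edge e gained, up to
-- the change of the derivative at f caused by e; as two edges lie in at most one
-- common triangle, this change is bounded by a constant.  Hence Φ decreases by
-- at most a constant for each edge of G, that is by O(nk) altogether, from about
-- (n / k) k³ / 6 at the start, and in the end each surviving triangle accounts for
-- 8 of it.  Degrees in G are at most k, so Constructor's moves are legal.

open import Defs
open import Data.Bool using (Bool; true; false; _∧_; _∨_; not; T?; if_then_else_)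
open import Data.Bool.Properties using (T-≡; ∨-zeroʳ; ∧-identityʳ)
open import Data.Fin using (Fin; toℕ)
open import Data.Fin.Properties using (toℕ-injective)
open import Data.List using (List; []; _∷_; _++_; map; length; concatMap; allFin; tabulate; filterᵇ)
open import Data.List.Extrema.Nat using (argmax; argmax-sel; f[⊥]≤f[argmax]; f[xs]≤f[argmax])
open import Data.List.Membership.Propositional using (_∈_; lose)
open import Data.List.Membership.Propositional.Properties using (∈-filter⁺; ∈-filter⁻; ∈-concatMap⁺; ∈-map⁺; ∈-allFin)
open import Data.List.Properties using (length-++; length-filter; map-++)
import Data.List.Relation.Unary.All as All
open import Data.List.Relation.Unary.Any using (here; there)
open import Data.Nat using (ℕ; zero; suc; _+_; _*_; _≤_; _<_; z≤n; s≤s; s≤s⁻¹; _<ᵇ_; _≡ᵇ_; _⊔_; _/_; _%_; NonZero)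
open import Data.Nat.Divisibility using (n∣m*n)
open import Data.Nat.DivMod using (m≡m%n+[m/n]*n; m/n*n≤m; m%n<n; m%n≤n; m*n/n≡m; m<n⇒m/n≡0; +-distrib-/-∣ˡ)
open import Data.Nat.ListAction using (sum)
open import Data.Nat.ListAction.Properties using (sum-++)
open import Data.Nat.Properties
open import Data.Nat.Solver using (module +-*-Solver)
open import Data.Product using (_×_; _,_; proj₁; proj₂; ∃-syntax)
open import Data.Sum using (inj₁; inj₂)
open import Function using (Equivalence)
open import Relation.Binary.PropositionalEquality using (_≡_; refl; sym; trans; cong; cong₂; subst; subst₂; module ≡-Reasoning)
open import Relation.Nullary using (contradiction)

private
  variable
    A : Set
    n : ℕ

-- Finite sums over lists

⟦_⟧ : Bool → ℕ
⟦ b ⟧ = if b then 1 else 0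

∑ : List A → (A → ℕ) → ℕ
∑ xs f = sum (map f xs)

∑-++ : (xs ys : List A) (f : A → ℕ) → ∑ (xs ++ ys) f ≡ ∑ xs f + ∑ ys f
∑-++ xs ys f = trans (cong sum (map-++ f xs ys)) (sum-++ (map f xs) (map f ys))

∑-cong : (xs : List A) {f g : A → ℕ} → (∀ x → f x ≡ g x) → ∑ xs f ≡ ∑ xs g
∑-cong []       f≡g = refl
∑-cong (x ∷ xs) f≡g = cong₂ _+_ (f≡g x) (∑-cong xs f≡g)

∑-mono : (xs : List A) {f g : A → ℕ} → (∀ x → f x ≤ g x) → ∑ xs f ≤ ∑ xs g
∑-mono []       f≤g = z≤n
∑-mono (x ∷ xs) f≤g = +-mono-≤ (f≤g x) (∑-mono xs f≤g)

∑-distrib-+ : (xs : List A) (f g : A → ℕ) → ∑ xs (λ x → f x + g x) ≡ ∑ xs f + ∑ xs g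
∑-distrib-+ []       f g = refl
∑-distrib-+ (x ∷ xs) f g = begin
  f x + g x + ∑ xs (λ y → f y + g y)  ≡⟨ cong (f x + g x +_) (∑-distrib-+ xs f g) ⟩
  f x + g x + (∑ xs f + ∑ xs g)       ≡⟨ +-+-interchange (f x) (g x) (∑ xs f) (∑ xs g) ⟩
  f x + ∑ xs f + (g x + ∑ xs g)       ∎
  where
  open ≡-Reasoning
  +-+-interchange : ∀ a b c d → a + b + (c + d) ≡ a + c + (b + d)
  +-+-interchange = solve 4 (λ a b c d → a :+ b :+ (c :+ d) := a :+ c :+ (b :+ d)) refl
    where open +-*-Solver

∑-distribˡ-* : (xs : List A) (c : ℕ) (f : A → ℕ) → ∑ xs (λ x → c * f x) ≡ c * ∑ xs f
∑-distribˡ-* []       c f = sym (*-zeroʳ c)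
∑-distribˡ-* (x ∷ xs) c f =
  trans (cong (c * f x +_) (∑-distribˡ-* xs c f)) (sym (*-distribˡ-+ c (f x) (∑ xs f)))

-- Serves to show that claiming a free edge lowers a count of free edges by the indicator of that
-- edge.
∑-mono-at : {xs : List A} {x : A} {f g : A → ℕ} {c : ℕ} → (∀ y → f y ≤ g y) →
            x ∈ xs → f x + c ≤ g x → ∑ xs f + c ≤ ∑ xs g
∑-mono-at {xs = x ∷ xs} {f = f} {g} {c} f≤g (here refl) fx+c≤gx = begin
  f x + ∑ xs f + c    ≡⟨ +-assoc (f x) _ c ⟩
  f x + (∑ xs f + c)  ≡⟨ cong (f x +_) (+-comm _ c) ⟩
  f x + (c + ∑ xs f)  ≡⟨ +-assoc (f x) c _ ⟨
  f x + c + ∑ xs f    ≤⟨ +-mono-≤ fx+c≤gx (∑-mono xs f≤g) ⟩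
  g x + ∑ xs g        ∎
  where open ≤-Reasoning
∑-mono-at {xs = y ∷ xs} {f = f} {g} {c} f≤g (there x∈xs) fx+c≤gx = begin
  f y + ∑ xs f + c    ≡⟨ +-assoc (f y) _ c ⟩
  f y + (∑ xs f + c)  ≤⟨ +-mono-≤ (f≤g y) (∑-mono-at f≤g x∈xs fx+c≤gx) ⟩
  g y + ∑ xs g        ∎
  where open ≤-Reasoning

∑-filterᵇ : (p : A → Bool) (xs : List A) (f : A → ℕ) →
            ∑ (filterᵇ p xs) f ≡ ∑ xs (λ x → ⟦ p x ⟧ * f x)
∑-filterᵇ p []       f = refl
∑-filterᵇ p (x ∷ xs) f with p x
... | true  = cong₂ _+_ (sym (+-identityʳ (f x))) (∑-filterᵇ p xs f)
... | false = ∑-filterᵇ p xs f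

length-filterᵇ : (p : A → Bool) (xs : List A) → length (filterᵇ p xs) ≡ ∑ xs (λ x → ⟦ p x ⟧)
length-filterᵇ p []       = refl
length-filterᵇ p (x ∷ xs) with p x
... | true  = cong suc (length-filterᵇ p xs)
... | false = length-filterᵇ p xs

length-concatMap : {B : Set} (f : A → List B) (xs : List A) →
                   length (concatMap f xs) ≡ ∑ xs (λ x → length (f x))
length-concatMap f []       = refl
length-concatMap f (x ∷ xs) =
  trans (length-++ (f x)) (cong (length (f x) +_) (length-concatMap f xs))

∑-concatMap : {B : Set} (f : A → List B) (xs : List A) (g : B → ℕ) →
              ∑ (concatMap f xs) g ≡ ∑ xs (λ x → ∑ (f x) g)
∑-concatMap f []       g = refl
∑-concatMap f (x ∷ xs) g =
  trans (∑-++ (f x) (concatMap f xs) g) (cong (∑ (f x) g +_) (∑-concatMap f xs g))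

∑-map : {B : Set} (f : A → B) (xs : List A) (g : B → ℕ) → ∑ (map f xs) g ≡ ∑ xs (λ x → g (f x))
∑-map f []       g = refl
∑-map f (x ∷ xs) g = cong (g (f x) +_) (∑-map f xs g)

∑-allEdges : (f : Edge n → ℕ) →
             ∑ (allEdges n) f ≡ ∑ (allFin n) λ i → ∑ (allFin n) λ j → ⟦ i << j ⟧ * f (i , j)
∑-allEdges {n} f = trans (∑-concatMap _ (allFin n) f) (∑-cong (allFin n) λ i →
  trans (∑-map (i ,_) (filterᵇ (i <<_) (allFin n)) f) (∑-filterᵇ (i <<_) (allFin n) _))

-- Sums over triples of vertices

∑³ : ∀ n → (Fin n → Fin n → Fin n → ℕ) → ℕ
∑³ n f = ∑ (allFin n) λ i → ∑ (allFin n) λ j → ∑ (allFin n) λ l → f i j l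

∑³-mono : {f g : Fin n → Fin n → Fin n → ℕ} → (∀ i j l → f i j l ≤ g i j l) → ∑³ n f ≤ ∑³ n g
∑³-mono {n} f≤g = ∑-mono (allFin n) λ i → ∑-mono (allFin n) λ j → ∑-mono (allFin n) (f≤g i j)

∑³-distrib-+ : (f g : Fin n → Fin n → Fin n → ℕ) →
               ∑³ n (λ i j l → f i j l + g i j l) ≡ ∑³ n f + ∑³ n g
∑³-distrib-+ {n} f g =
  trans (∑-cong (allFin n) λ i →
    trans (∑-cong (allFin n) λ j → ∑-distrib-+ (allFin n) (f i j) (g i j))
          (∑-distrib-+ (allFin n) _ _))
  (∑-distrib-+ (allFin n) _ _)

∑³-distribˡ-* : (c : ℕ) (f : Fin n → Fin n → Fin n → ℕ) → ∑³ n (λ i j l → c * f i j l) ≡ c * ∑³ n f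
∑³-distribˡ-* {n} c f =
  trans (∑-cong (allFin n) λ i →
    trans (∑-cong (allFin n) λ j → ∑-distribˡ-* (allFin n) c (f i j))
          (∑-distribˡ-* (allFin n) c _))
  (∑-distribˡ-* (allFin n) c _)

triangles≡∑³ : (C : List (Edge n)) → triangles C ≡
  ∑³ n λ i j l → ⟦ (i << j) ∧ (j << l) ∧ adj C i j ∧ adj C j l ∧ adj C i l ⟧
triangles≡∑³ {n} C =
  trans (length-concatMap _ (allFin n)) (∑-cong (allFin n) λ i →
  trans (length-concatMap _ (allFin n)) (∑-cong (allFin n) λ j →
  length-filterᵇ _ (allFin n)))

-- Sums over initial segments of the naturals

-- Indices in ℕ can be shifted into a block without carrying bound proofs; `∑-allFin` translates
-- from sums over vertices.
∑< : ℕ → (ℕ → ℕ) → ℕ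
∑< zero    f = 0
∑< (suc n) f = f 0 + ∑< n (λ i → f (suc i))

∑<-mono : ∀ n {f g : ℕ → ℕ} → (∀ i → i < n → f i ≤ g i) → ∑< n f ≤ ∑< n g
∑<-mono zero    f≤g = z≤n
∑<-mono (suc n) f≤g = +-mono-≤ (f≤g 0 (s≤s z≤n)) (∑<-mono n λ i i<n → f≤g (suc i) (s≤s i<n))

∑<-zero : ∀ n → ∑< n (λ _ → 0) ≡ 0
∑<-zero zero    = refl
∑<-zero (suc n) = ∑<-zero n

∑<-+ : ∀ m n (f : ℕ → ℕ) → ∑< (m + n) f ≡ ∑< m f + ∑< n (λ i → f (m + i))
∑<-+ zero    n f = refl
∑<-+ (suc m) n f = trans (cong (f 0 +_) (∑<-+ m n (λ i → f (suc i)))) (sym (+-assoc (f 0) _ _))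

∑<-interval : ∀ a b {n} (f : ℕ → ℕ) → a + b ≤ n → ∑< b (λ i → f (a + i)) ≤ ∑< n f
∑<-interval a b {n} f a+b≤n with m≤n⇒∃[o]m+o≡n a+b≤n
... | c , refl = begin
  ∑< b (λ i → f (a + i))           ≤⟨ m≤n+m _ (∑< a f) ⟩
  ∑< a f + ∑< b (λ i → f (a + i))  ≡⟨ ∑<-+ a b f ⟨
  ∑< (a + b) f                     ≤⟨ m≤m+n _ _ ⟩
  ∑< (a + b) f + _                 ≡⟨ ∑<-+ (a + b) c f ⟨
  ∑< (a + b + c) f                 ∎
  where open ≤-Reasoning

∑-tabulate : ∀ n (g : Fin n → A) {f : A → ℕ} {h : ℕ → ℕ} →
             (∀ i → f (g i) ≡ h (toℕ i)) → ∑ (tabulate g) f ≡ ∑< n h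
∑-tabulate zero    g f≡h = refl
∑-tabulate (suc n) g f≡h =
  cong₂ _+_ (f≡h Fin.zero) (∑-tabulate n (λ i → g (Fin.suc i)) (λ i → f≡h (Fin.suc i)))

∑-allFin : ∀ n (h : ℕ → ℕ) → ∑ (allFin n) (λ i → h (toℕ i)) ≡ ∑< n h
∑-allFin n h = ∑-tabulate n (λ i → i) (λ i → refl)

-- Indicators and equality of vertices and edges

==⇒≡ : (i j : Fin n) → (i == j) ≡ true → i ≡ j
==⇒≡ i j i==j = toℕ-injective (≡ᵇ⇒≡ (toℕ i) (toℕ j) (Equivalence.from T-≡ i==j))

≡ᵇ-refl : ∀ m → (m ≡ᵇ m) ≡ true
≡ᵇ-refl m = Equivalence.to T-≡ (≡⇒≡ᵇ m m refl)

∑<-δ : ∀ n m → ∑< n (λ i → ⟦ i ≡ᵇ m ⟧) ≤ 1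
∑<-δ zero    m       = z≤n
∑<-δ (suc n) zero    = s≤s (≤-reflexive (∑<-zero n))
∑<-δ (suc n) (suc m) = ∑<-δ n m

∑-δ : (a : Fin n) (f : Fin n → ℕ) → ∑ (allFin n) (λ i → ⟦ i == a ⟧ * f i) ≤ f a
∑-δ {n} a f = begin
  ∑ (allFin n) (λ i → ⟦ i == a ⟧ * f i)  ≡⟨ ∑-cong (allFin n) pointwise ⟩
  ∑ (allFin n) (λ i → f a * ⟦ i == a ⟧)  ≡⟨ ∑-distribˡ-* (allFin n) (f a) _ ⟩
  f a * ∑ (allFin n) (λ i → ⟦ i == a ⟧)  ≡⟨ cong (f a *_) (∑-allFin n (λ i → ⟦ i ≡ᵇ toℕ a ⟧)) ⟩
  f a * ∑< n (λ i → ⟦ i ≡ᵇ toℕ a ⟧)      ≤⟨ *-monoʳ-≤ (f a) (∑<-δ n (toℕ a)) ⟩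
  f a * 1                                ≡⟨ *-identityʳ (f a) ⟩
  f a                                    ∎
  where
  open ≤-Reasoning
  pointwise : ∀ i → ⟦ i == a ⟧ * f i ≡ f a * ⟦ i == a ⟧
  pointwise i with i == a in eq
  ... | false = sym (*-zeroʳ (f a))
  ... | true  rewrite ==⇒≡ i a eq = *-comm 1 (f a)

-- Three uses of `∑-δ`, the innermost one for the constant function 1, whence the final factor.
∑³-δ : (a b c : Fin n) → ∑³ n (λ i j l → ⟦ i == a ⟧ * (⟦ j == b ⟧ * (⟦ l == c ⟧ * 1))) ≤ 1
∑³-δ {n} a b c = begin
  ∑³ n (λ i j l → ⟦ i == a ⟧ * (⟦ j == b ⟧ * (⟦ l == c ⟧ * 1)))
    ≡⟨ ∑-cong (allFin n) (λ i → trans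
         (∑-cong (allFin n) λ j → ∑-distribˡ-* (allFin n) ⟦ i == a ⟧ _)
         (∑-distribˡ-* (allFin n) ⟦ i == a ⟧ _)) ⟩
  ∑ (allFin n) (λ i → ⟦ i == a ⟧ * ∑ (allFin n) λ j → ∑ (allFin n) λ l → ⟦ j == b ⟧ * (⟦ l == c ⟧ * 1))
    ≤⟨ ∑-δ a (λ _ → ∑ (allFin n) λ j → ∑ (allFin n) λ l → ⟦ j == b ⟧ * (⟦ l == c ⟧ * 1)) ⟩
  ∑ (allFin n) (λ j → ∑ (allFin n) λ l → ⟦ j == b ⟧ * (⟦ l == c ⟧ * 1))
    ≡⟨ ∑-cong (allFin n) (λ j → ∑-distribˡ-* (allFin n) ⟦ j == b ⟧ _) ⟩
  ∑ (allFin n) (λ j → ⟦ j == b ⟧ * ∑ (allFin n) λ l → ⟦ l == c ⟧ * 1)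
    ≤⟨ ∑-δ b (λ _ → ∑ (allFin n) λ l → ⟦ l == c ⟧ * 1) ⟩
  ∑ (allFin n) (λ l → ⟦ l == c ⟧ * 1)
    ≤⟨ ∑-δ c (λ _ → 1) ⟩
  1 ∎
  where open ≤-Reasoning

⟦⟧-mono : ∀ {a b} → (a ≡ true → b ≡ true) → ⟦ a ⟧ ≤ ⟦ b ⟧
⟦⟧-mono {false} a⇒b = z≤n
⟦⟧-mono {true}  a⇒b rewrite a⇒b refl = ≤-refl

⟦⟧≤1 : ∀ b → ⟦ b ⟧ ≤ 1
⟦⟧≤1 false = z≤n
⟦⟧≤1 true  = ≤-refl

sameEdge-refl : (e : Edge n) → sameEdge e e ≡ true
sameEdge-refl (a , b) rewrite ≡ᵇ-refl (toℕ a) | ≡ᵇ-refl (toℕ b) = refl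

sameEdge⇒≡ : (e f : Edge n) → sameEdge e f ≡ true → e ≡ f
sameEdge⇒≡ (a , b) (c , d) eq with a == c in a==c
... | true = cong₂ _,_ (==⇒≡ a c a==c) (==⇒≡ b d eq)

-- Expansion of the weight of a triangle

-- prod x i j l is the weight of the triangle ijl when the edges have weights x;
-- ∂ x p is its derivative at x in the direction p, and ∂² q p its mixed second
-- derivative with the remaining edge weight dropped.
prod : (Edge n → ℕ) → Fin n → Fin n → Fin n → ℕ
prod x i j l = x (i , j) * x (j , l) * x (i , l)

∂ : (x p : Edge n → ℕ) → Fin n → Fin n → Fin n → ℕ
∂ x p i j l = p (i , j) * (x (j , l) * x (i , l))
            + p (j , l) * (x (i , j) * x (i , l))
            + p (i , l) * (x (i , j) * x (j , l))

∂² : (q p : Edge n → ℕ) → Fin n → Fin n → Fin n → ℕ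
∂² q p i j l = q (i , j) * p (j , l) + q (i , j) * p (i , l)
             + (q (j , l) * p (i , j) + q (j , l) * p (i , l))
             + (q (i , l) * p (i , j) + q (i , l) * p (j , l))

-- Expanding the product around the smaller point `x`, the terms with two or three factors from `p`
-- are discarded.
prod-+-≥ : (x p x′ : Edge n → ℕ) → (∀ e → x′ e ≡ x e + p e) →
           ∀ i j l → prod x i j l + ∂ x p i j l ≤ prod x′ i j l
prod-+-≥ x p x′ x′≡ i j l rewrite x′≡ (i , j) | x′≡ (j , l) | x′≡ (i , l) =
  ≤-trans (m≤m+n _ _) (≤-reflexive (identity (x (i , j)) (x (j , l)) (x (i , l)) (p (i , j)) (p (j , l)) (p (i , l))))
  where
  identity : ∀ x y z p q r →
    x * y * z + (p * (y * z) + q * (x * z) + r * (x * y)) + (x * q * r + y * p * r + z * p * q + p * q * r)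
    ≡ (x + p) * (y + q) * (z + r)
  identity = solve 6 (λ x y z p q r →
    x :* y :* z :+ (p :* (y :* z) :+ q :* (x :* z) :+ r :* (x :* y))
      :+ (x :* q :* r :+ y :* p :* r :+ z :* p :* q :+ p :* q :* r)
    := (x :+ p) :* (y :+ q) :* (z :+ r)) refl
    where open +-*-Solver

-- With the derivative taken at the larger point `x′`, terms with two factors from `p` are counted
-- twice and the one with three factors three times, so the linear estimate overshoots.
prod-+-≤ : (x p x′ : Edge n → ℕ) → (∀ e → x′ e ≡ x e + p e) →
           ∀ i j l → prod x′ i j l ≤ prod x i j l + ∂ x′ p i j l
prod-+-≤ x p x′ x′≡ i j l rewrite x′≡ (i , j) | x′≡ (j , l) | x′≡ (i , l) =
  ≤-trans (m≤m+n _ _) (≤-reflexive (identity (x (i , j)) (x (j , l)) (x (i , l)) (p (i , j)) (p (j , l)) (p (i , l))))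
  where
  identity : ∀ x y z p q r →
    (x + p) * (y + q) * (z + r) + (x * q * r + y * p * r + z * p * q + 2 * (p * q * r))
    ≡ x * y * z + (p * ((y + q) * (z + r)) + q * ((x + p) * (z + r)) + r * ((x + p) * (y + q)))
  identity = solve 6 (λ x y z p q r →
    (x :+ p) :* (y :+ q) :* (z :+ r)
      :+ (x :* q :* r :+ y :* p :* r :+ z :* p :* q :+ con 2 :* (p :* q :* r))
    := x :* y :* z :+ (p :* ((y :+ q) :* (z :+ r)) :+ q :* ((x :+ p) :* (z :+ r)) :+ r :* ((x :+ p) :* (y :+ q)))) refl
    where open +-*-Solver

-- In each summand only the product of two weights changes. Every new term has a factor from `p`,
-- and the other factor is at most an updated weight, hence at most 2.
∂-+-≤ : (x p x′ q : Edge n → ℕ) → (∀ e → x′ e ≡ x e + p e) → (∀ e → x′ e ≤ 2) →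
        ∀ i j l → ∂ x′ q i j l ≤ ∂ x q i j l + 2 * ∂² q p i j l
∂-+-≤ x p x′ q x′≡ x′≤2 i j l = begin
  ∂ x′ q i j l
    ≤⟨ +-mono-≤ (+-mono-≤ (*-monoʳ-≤ (q ij) (product-≤ jl il))
                          (*-monoʳ-≤ (q jl) (product-≤ ij il)))
                (*-monoʳ-≤ (q il) (product-≤ ij jl)) ⟩
  _ ≡⟨ identity (q ij) (q jl) (q il) (x ij) (x jl) (x il) (p ij) (p jl) (p il) ⟩
  ∂ x q i j l + 2 * ∂² q p i j l ∎
  where
  open ≤-Reasoning
  ij = i , j
  jl = j , l
  il = i , l
  expand : ∀ a b c d → (a + c) * (b + d) ≡ a * b + d * a + c * (b + d)
  expand = solve 4 (λ a b c d → (a :+ c) :* (b :+ d) := a :* b :+ d :* a :+ c :* (b :+ d)) refl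
    where open +-*-Solver
  product-≤ : ∀ e f → x′ e * x′ f ≤ x e * x f + p f * 2 + p e * 2
  product-≤ e f = begin
    x′ e * x′ f                                  ≡⟨ cong₂ _*_ (x′≡ e) (x′≡ f) ⟩
    (x e + p e) * (x f + p f)                    ≡⟨ expand (x e) (x f) (p e) (p f) ⟩
    x e * x f + p f * x e + p e * (x f + p f)
      ≤⟨ +-mono-≤ (+-monoʳ-≤ (x e * x f) (*-monoʳ-≤ (p f) (≤-trans (m≤m+n (x e) (p e)) (subst (_≤ 2) (x′≡ e) (x′≤2 e)))))
                  (*-monoʳ-≤ (p e) (subst (_≤ 2) (x′≡ f) (x′≤2 f))) ⟩
    x e * x f + p f * 2 + p e * 2                ∎
  identity : ∀ u v w x y z p q r →
    u * (y * z + r * 2 + q * 2) + v * (x * z + r * 2 + p * 2) + w * (x * y + q * 2 + p * 2)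
    ≡ u * (y * z) + v * (x * z) + w * (x * y) + 2 * (u * q + u * r + (v * p + v * r) + (w * p + w * q))
  identity = solve 9 (λ u v w x y z p q r →
    u :* (y :* z :+ r :* con 2 :+ q :* con 2) :+ v :* (x :* z :+ r :* con 2 :+ p :* con 2)
      :+ w :* (x :* y :+ q :* con 2 :+ p :* con 2)
    := u :* (y :* z) :+ v :* (x :* z) :+ w :* (x :* y)
      :+ con 2 :* (u :* q :+ u :* r :+ (v :* p :+ v :* r) :+ (w :* p :+ w :* q))) refl
    where open +-*-Solver

at : Edge n → Edge n → ℕ
at f e = ⟦ sameEdge e f ⟧

-- Two edges of a triple, together with their positions, determine the triple.
∑³-∂²-at : (f e : Edge n) → ∑³ n (∂² (at f) (at e)) ≤ 6
∑³-∂²-at {n} f@(c , d) e@(a , b) = begin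
  ∑³ n (∂² (at f) (at e))
    ≤⟨ ∑³-mono (λ i j l → +-mono-≤ (+-mono-≤
         (+-mono-≤ (1-2-4 (i == c) (j == d) (j == a) (l == b)) (1-2-4 (i == c) (j == d) (i == a) (l == b)))
         (+-mono-≤ (3-1-2 (j == c) (l == d) (i == a) (j == b)) (3-1-2 (j == c) (l == d) (i == a) (l == b))))
         (+-mono-≤ (1-4-2 (i == c) (l == d) (i == a) (j == b)) (1-3-2 (i == c) (l == d) (j == a) (l == b)))) ⟩
  ∑³ n ((δ c d b ⊕ δ c d b) ⊕ (δ a c d ⊕ δ a c d) ⊕ (δ c b d ⊕ δ c a d))
    ≡⟨ ∑³-distrib-+ ((δ c d b ⊕ δ c d b) ⊕ (δ a c d ⊕ δ a c d)) (δ c b d ⊕ δ c a d) ⟩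
  ∑³ n ((δ c d b ⊕ δ c d b) ⊕ (δ a c d ⊕ δ a c d)) + ∑³ n (δ c b d ⊕ δ c a d)
    ≡⟨ cong₂ _+_ (∑³-distrib-+ (δ c d b ⊕ δ c d b) (δ a c d ⊕ δ a c d)) (∑³-distrib-+ (δ c b d) (δ c a d)) ⟩
  ∑³ n (δ c d b ⊕ δ c d b) + ∑³ n (δ a c d ⊕ δ a c d) + (∑³ n (δ c b d) + ∑³ n (δ c a d))
    ≡⟨ cong (_+ (∑³ n (δ c b d) + ∑³ n (δ c a d)))
         (cong₂ _+_ (∑³-distrib-+ (δ c d b) (δ c d b)) (∑³-distrib-+ (δ a c d) (δ a c d))) ⟩
  ∑³ n (δ c d b) + ∑³ n (δ c d b) + (∑³ n (δ a c d) + ∑³ n (δ a c d)) + (∑³ n (δ c b d) + ∑³ n (δ c a d))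
    ≤⟨ +-mono-≤ (+-mono-≤ (+-mono-≤ (∑³-δ c d b) (∑³-δ c d b)) (+-mono-≤ (∑³-δ a c d) (∑³-δ a c d)))
                (+-mono-≤ (∑³-δ c b d) (∑³-δ c a d)) ⟩
  6 ∎
  where
  open ≤-Reasoning
  δ : Fin n → Fin n → Fin n → Fin n → Fin n → Fin n → ℕ
  δ a b c i j l = ⟦ i == a ⟧ * (⟦ j == b ⟧ * (⟦ l == c ⟧ * 1))
  infixl 6 _⊕_
  _⊕_ : (f g : Fin n → Fin n → Fin n → ℕ) → Fin n → Fin n → Fin n → ℕ
  (f ⊕ g) i j l = f i j l + g i j l
  -- The digits tell which of the four tests are kept, in the order in which they fix `i`, `j` and
  -- `l`; omitting a test can only increase the product.
  1-2-4 : ∀ s t u v → ⟦ s ∧ t ⟧ * ⟦ u ∧ v ⟧ ≤ ⟦ s ⟧ * (⟦ t ⟧ * (⟦ v ⟧ * 1))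
  1-2-4 false t     u     v     = z≤n
  1-2-4 true  false u     v     = z≤n
  1-2-4 true  true  false v     = z≤n
  1-2-4 true  true  true  false = z≤n
  1-2-4 true  true  true  true  = ≤-refl
  3-1-2 : ∀ s t u v → ⟦ s ∧ t ⟧ * ⟦ u ∧ v ⟧ ≤ ⟦ u ⟧ * (⟦ s ⟧ * (⟦ t ⟧ * 1))
  3-1-2 false t     u     v     = z≤n
  3-1-2 true  false u     v     = z≤n
  3-1-2 true  true  false v     = z≤n
  3-1-2 true  true  true  false = z≤n
  3-1-2 true  true  true  true  = ≤-refl
  1-4-2 : ∀ s t u v → ⟦ s ∧ t ⟧ * ⟦ u ∧ v ⟧ ≤ ⟦ s ⟧ * (⟦ v ⟧ * (⟦ t ⟧ * 1))
  1-4-2 false t     u     v     = z≤n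
  1-4-2 true  false u     v     = z≤n
  1-4-2 true  true  false v     = z≤n
  1-4-2 true  true  true  false = z≤n
  1-4-2 true  true  true  true  = ≤-refl
  1-3-2 : ∀ s t u v → ⟦ s ∧ t ⟧ * ⟦ u ∧ v ⟧ ≤ ⟦ s ⟧ * (⟦ u ⟧ * (⟦ t ⟧ * 1))
  1-3-2 false t     u     v     = z≤n
  1-3-2 true  false u     v     = z≤n
  1-3-2 true  true  false v     = z≤n
  1-3-2 true  true  true  false = z≤n
  1-3-2 true  true  true  true  = ≤-refl

-- Edge weights and free edges in a position

free : (C B : List (Edge n)) → Edge n → Bool
free C B e = not (e ∈ᵇ C ∨ e ∈ᵇ B)

free⇒∉C : (C B : List (Edge n)) (e : Edge n) → free C B e ≡ true → e ∈ᵇ C ≡ false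
free⇒∉C C B e eq with e ∈ᵇ C
... | false = refl

free⇒∉B : (C B : List (Edge n)) (e : Edge n) → free C B e ≡ true → e ∈ᵇ B ≡ false
free⇒∉B C B e eq with e ∈ᵇ C | e ∈ᵇ B
... | false | false = refl

weight : (C B : List (Edge n)) → Edge n → ℕ
weight C B e = if e ∈ᵇ B then 0 else if e ∈ᵇ C then 2 else 1

weight≤2 : (C B : List (Edge n)) (e : Edge n) → weight C B e ≤ 2
weight≤2 C B e with e ∈ᵇ B | e ∈ᵇ C
... | true  | _     = z≤n
... | false | true  = ≤-refl
... | false | false = s≤s z≤n

weight-claimC : (C B : List (Edge n)) (f : Edge n) → free C B f ≡ true →
                ∀ e → weight (f ∷ C) B e ≡ weight C B e + at f e
weight-claimC C B f free-f e with sameEdge e f in eq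
... | false = sym (+-identityʳ _)
... | true rewrite sameEdge⇒≡ e f eq | free⇒∉C C B f free-f | free⇒∉B C B f free-f = refl

-- The weight of `f` drops from 1 to 0. The old weights are written as the sum, so that no
-- subtraction occurs.
weight-claimB : (C B : List (Edge n)) (f : Edge n) → free C B f ≡ true →
                ∀ e → weight C B e ≡ weight C (f ∷ B) e + at f e
weight-claimB C B f free-f e with sameEdge e f in eq
... | false = sym (+-identityʳ _)
... | true rewrite sameEdge⇒≡ e f eq | free⇒∉C C B f free-f | free⇒∉B C B f free-f = refl

-- Used with three choices of `H`: all edges, to compare with the fuel; the edges of `G`, to bound
-- the total loss; the edges of `G` at one vertex, to keep moves legal.
count : (Edge n → Bool) → (C B : List (Edge n)) → ℕ
count {n} H C B = ∑ (allEdges n) λ e → ⟦ H e ∧ free C B e ⟧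

count-claimC : (H : Edge n → Bool) (C B : List (Edge n)) {e : Edge n} →
               e ∈ allEdges n → free C B e ≡ true → count H (e ∷ C) B + ⟦ H e ⟧ ≤ count H C B
count-claimC H C B {e} e∈ free-e = ∑-mono-at pointwise e∈ at-e
  where
  pointwise : ∀ y → ⟦ H y ∧ free (e ∷ C) B y ⟧ ≤ ⟦ H y ∧ free C B y ⟧
  pointwise y with H y | sameEdge y e
  ... | false | _     = z≤n
  ... | true  | true  = z≤n
  ... | true  | false = ≤-refl
  at-e : ⟦ H e ∧ free (e ∷ C) B e ⟧ + ⟦ H e ⟧ ≤ ⟦ H e ∧ free C B e ⟧
  at-e rewrite sameEdge-refl e | free-e with H e
  ... | true  = ≤-refl
  ... | false = ≤-refl

count-claimB : (H : Edge n → Bool) (C B : List (Edge n)) {e : Edge n} →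
               e ∈ allEdges n → free C B e ≡ true → count H C (e ∷ B) + ⟦ H e ⟧ ≤ count H C B
count-claimB H C B {e} e∈ free-e = ∑-mono-at pointwise e∈ at-e
  where
  pointwise : ∀ y → ⟦ H y ∧ free C (e ∷ B) y ⟧ ≤ ⟦ H y ∧ free C B y ⟧
  pointwise y with H y | y ∈ᵇ C | sameEdge y e
  ... | false | _     | _     = z≤n
  ... | true  | true  | _     = z≤n
  ... | true  | false | true  = z≤n
  ... | true  | false | false = ≤-refl
  at-e : ⟦ H e ∧ free C (e ∷ B) e ⟧ + ⟦ H e ⟧ ≤ ⟦ H e ∧ free C B e ⟧
  at-e rewrite sameEdge-refl e | free-e | ∨-zeroʳ (e ∈ᵇ C) with H e
  ... | true  = ≤-refl
  ... | false = ≤-refl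

-- Membership of edges, monotonicity of triangles and minimax values

∈-filterᵇ⁺ : {p : A → Bool} {xs : List A} {x : A} → x ∈ xs → p x ≡ true → x ∈ filterᵇ p xs
∈-filterᵇ⁺ {p = p} x∈xs px = ∈-filter⁺ (λ x → T? (p x)) x∈xs (Equivalence.from T-≡ px)

∈-filterᵇ⁻ : {p : A → Bool} {xs : List A} {x : A} → x ∈ filterᵇ p xs → x ∈ xs × p x ≡ true
∈-filterᵇ⁻ {p = p} x∈ with ∈-filter⁻ (λ x → T? (p x)) x∈
... | x∈xs , px = x∈xs , Equivalence.to T-≡ px

∈-allEdges : {i j : Fin n} → (i << j) ≡ true → (i , j) ∈ allEdges n
∈-allEdges {i = i} {j} i<<j =
  ∈-concatMap⁺ _ (lose (∈-allFin i) (∈-map⁺ (i ,_) (∈-filterᵇ⁺ (∈-allFin j) i<<j)))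

triangles-∷ : (e : Edge n) (C : List (Edge n)) → triangles C ≤ triangles (e ∷ C)
triangles-∷ {n} e C = subst₂ _≤_ (sym (triangles≡∑³ C)) (sym (triangles≡∑³ (e ∷ C)))
  (∑³-mono λ i j l → mono (i << j) (j << l) (adj C i j) (adj C j l) (adj C i l) (new i j) (new j l) (new i l))
  where
  new : Fin n → Fin n → Bool
  new u v = sameEdge (u , v) e ∨ sameEdge (v , u) e
  mono : ∀ a b x y z x′ y′ z′ →
         ⟦ a ∧ b ∧ x ∧ y ∧ z ⟧ ≤ ⟦ a ∧ b ∧ (x′ ∨ x) ∧ (y′ ∨ y) ∧ (z′ ∨ z) ⟧
  mono false b     x     y     z     x′ y′ z′ = z≤n
  mono true  false x     y     z     x′ y′ z′ = z≤n
  mono true  true  false y     z     x′ y′ z′ = z≤n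
  mono true  true  true  false z     x′ y′ z′ = z≤n
  mono true  true  true  true  false x′ y′ z′ = z≤n
  mono true  true  true  true  true  x′ y′ z′
    rewrite ∨-zeroʳ x′ | ∨-zeroʳ y′ | ∨-zeroʳ z′ = ≤-refl

maxOver-upper : (f : A → ℕ) {xs : List A} {x : A} → x ∈ xs → f x ≤ maxOver f xs
maxOver-upper f (here refl)  = m≤m⊔n _ _
maxOver-upper f (there x∈xs) = ≤-trans (maxOver-upper f x∈xs) (m≤n⊔m _ _)

-- The minimum is attained, so it is one of the values for which `P` is known.
minOver1-preserves : (P : ℕ → Set) (f : A → ℕ) (x : A) (xs : List A) →
                     (∀ {y} → y ∈ x ∷ xs → P (f y)) → P (minOver1 f x xs)
minOver1-preserves P f x []       all = all (here refl)
minOver1-preserves P f x (y ∷ ys) all with ⊓-sel (f y) (minOver1 f x ys)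
... | inj₁ eq = subst P (sym eq) (all (there (here refl)))
... | inj₂ eq = subst P (sym eq) (minOver1-preserves P f x ys
  λ { (here z≡x) → all (here z≡x) ; (there z∈ys) → all (there (there z∈ys)) })

valC-upper : ∀ k f (C B : List (Edge n)) {e} → e ∈ filterᵇ (legalC k C) (unclaimed C B) →
             valB k f (e ∷ C) B ≤ valC k (suc f) C B
valC-upper k f C B e∈ with filterᵇ (legalC k C) (unclaimed C B)
... | m ∷ ms = maxOver-upper (λ e → valB k f (e ∷ C) B) e∈

valB-preserves : (P : ℕ → Set) → ∀ k f (C B : List (Edge n)) →
                 (unclaimed C B ≡ [] → P (triangles C)) →
                 (∀ {e} → e ∈ unclaimed C B → P (valC k f C (e ∷ B))) → P (valB k (suc f) C B)
valB-preserves P k f C B stop move with unclaimed C B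
... | []     = stop refl
... | e ∷ es = minOver1-preserves P (λ e → valC k f C (e ∷ B)) e es move

-- Claimed edges are never lost, so further play cannot destroy triangles. Hence the analysis may
-- stop once `G` has no free edge, although the game goes on.
triangles≤valC : ∀ k f (C B : List (Edge n)) → triangles C ≤ valC k f C B
triangles≤valB : ∀ k f (C B : List (Edge n)) → triangles C ≤ valB k f C B

triangles≤valC k zero    C B = ≤-refl
triangles≤valC k (suc f) C B with filterᵇ (legalC k C) (unclaimed C B)
... | []     = ≤-refl
... | e ∷ es = begin
  triangles C                                      ≤⟨ triangles-∷ e C ⟩
  triangles (e ∷ C)                                ≤⟨ triangles≤valB k f (e ∷ C) B ⟩
  valB k f (e ∷ C) B                               ≤⟨ m≤m⊔n _ _ ⟩
  maxOver (λ e → valB k f (e ∷ C) B) (e ∷ es)      ∎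
  where open ≤-Reasoning

triangles≤valB k zero    C B = ≤-refl
triangles≤valB k (suc f) C B = valB-preserves (triangles C ≤_) k f C B
  (λ _ → ≤-refl) (λ {e} _ → triangles≤valC k f C (e ∷ B))

∈ᵇ⇒adj : (C : List (Edge n)) {i j : Fin n} → (i , j) ∈ᵇ C ≡ true → adj C i j ≡ true
∈ᵇ⇒adj (e ∷ C) {i} {j} ij∈C with sameEdge (i , j) e
... | true  = refl
... | false = trans (cong (sameEdge (j , i) e ∨_) (∈ᵇ⇒adj C {i} {j} ij∈C)) (∨-zeroʳ _)

-- Incidence and degrees

incident : Fin n → Edge n → Bool
incident a e = (proj₁ e == a) ∨ (proj₂ e == a)

deg-∷ : (e : Edge n) (C : List (Edge n)) (a : Fin n) → deg (e ∷ C) a ≡ ⟦ incident a e ⟧ + deg C a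
deg-∷ e C a with incident a e
... | true  = refl
... | false = refl

<ᵇ-trans : ∀ a b c → (a <ᵇ b) ≡ true → (b <ᵇ c) ≡ true → (a <ᵇ c) ≡ true
<ᵇ-trans a b c a<b b<c = Equivalence.to T-≡ (<⇒<ᵇ (<-trans (<ᵇ⇒< a b (Equivalence.from T-≡ a<b)) (<ᵇ⇒< b c (Equivalence.from T-≡ b<c))))

all : Edge n → Bool
all _ = true

length-unclaimed : (C B : List (Edge n)) → length (unclaimed C B) ≡ count all C B
length-unclaimed {n} C B = length-filterᵇ (free C B) (allEdges n)

-- Constructor plays only edges of the graph G, whose maximum degree is at most k.
module Board {n} (k : ℕ) (G : Edge n → Bool) where

  -- The potential and its derivative

  inside : Fin n → Fin n → Fin n → Bool
  inside i j l = (i << j) ∧ (j << l) ∧ G (i , j) ∧ G (j , l) ∧ G (i , l)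

  Φ : (Edge n → ℕ) → ℕ
  Φ x = ∑³ n λ i j l → ⟦ inside i j l ⟧ * prod x i j l

  -- The derivative of `Φ` at `x` in the direction `p`; for `p = at e` it is the partial derivative
  -- with respect to the weight of `e`.
  D : (x p : Edge n → ℕ) → ℕ
  D x p = ∑³ n λ i j l → ⟦ inside i j l ⟧ * ∂ x p i j l

  Φ-+-≥ : (x p x′ : Edge n → ℕ) → (∀ e → x′ e ≡ x e + p e) → Φ x + D x p ≤ Φ x′
  Φ-+-≥ x p x′ x′≡ = begin
    Φ x + D x p
      ≡⟨ ∑³-distrib-+ (λ i j l → ⟦ inside i j l ⟧ * prod x i j l) (λ i j l → ⟦ inside i j l ⟧ * ∂ x p i j l) ⟨
    ∑³ n (λ i j l → ⟦ inside i j l ⟧ * prod x i j l + ⟦ inside i j l ⟧ * ∂ x p i j l)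
      ≤⟨ ∑³-mono (λ i j l → ≤-trans
           (≤-reflexive (sym (*-distribˡ-+ ⟦ inside i j l ⟧ (prod x i j l) (∂ x p i j l))))
           (*-monoʳ-≤ ⟦ inside i j l ⟧ (prod-+-≥ x p x′ x′≡ i j l))) ⟩
    Φ x′ ∎
    where open ≤-Reasoning

  Φ-+-≤ : (x p x′ : Edge n → ℕ) → (∀ e → x′ e ≡ x e + p e) → Φ x′ ≤ Φ x + D x′ p
  Φ-+-≤ x p x′ x′≡ = begin
    Φ x′
      ≤⟨ ∑³-mono (λ i j l → ≤-trans
           (*-monoʳ-≤ ⟦ inside i j l ⟧ (prod-+-≤ x p x′ x′≡ i j l))
           (≤-reflexive (*-distribˡ-+ ⟦ inside i j l ⟧ (prod x i j l) (∂ x′ p i j l)))) ⟩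
    ∑³ n (λ i j l → ⟦ inside i j l ⟧ * prod x i j l + ⟦ inside i j l ⟧ * ∂ x′ p i j l)
      ≡⟨ ∑³-distrib-+ (λ i j l → ⟦ inside i j l ⟧ * prod x i j l) (λ i j l → ⟦ inside i j l ⟧ * ∂ x′ p i j l) ⟩
    Φ x + D x′ p ∎
    where open ≤-Reasoning

  -- The constant is 2 · 6: the factor 2 of `∂-+-≤`, times the six ways in which `f` and `e` can
  -- take two positions in a triple.
  D-at-≤ : (x x′ : Edge n → ℕ) (f e : Edge n) → (∀ y → x′ y ≡ x y + at e y) → (∀ y → x′ y ≤ 2) →
           D x′ (at f) ≤ D x (at f) + 12
  D-at-≤ x x′ f e x′≡ x′≤2 = begin
    D x′ (at f)
      ≤⟨ ∑³-mono (λ i j l → pointwise (inside i j l) (∂-+-≤ x (at e) x′ (at f) x′≡ x′≤2 i j l)) ⟩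
    ∑³ n (λ i j l → ⟦ inside i j l ⟧ * ∂ x (at f) i j l + 2 * ∂² (at f) (at e) i j l)
      ≡⟨ ∑³-distrib-+ (λ i j l → ⟦ inside i j l ⟧ * ∂ x (at f) i j l) (λ i j l → 2 * ∂² (at f) (at e) i j l) ⟩
    D x (at f) + ∑³ n (λ i j l → 2 * ∂² (at f) (at e) i j l)
      ≡⟨ cong (D x (at f) +_) (∑³-distribˡ-* 2 (∂² (at f) (at e))) ⟩
    D x (at f) + 2 * ∑³ n (∂² (at f) (at e))
      ≤⟨ +-monoʳ-≤ (D x (at f)) (*-monoʳ-≤ 2 (∑³-∂²-at f e)) ⟩
    D x (at f) + 12 ∎
    where
    open ≤-Reasoning
    pointwise : ∀ b {u v w} → u ≤ v + w → ⟦ b ⟧ * u ≤ ⟦ b ⟧ * v + w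
    pointwise false u≤ = z≤n
    pointwise true {u} {v} u≤ rewrite +-identityʳ u | +-identityʳ v = u≤

  -- An edge outside `G` lies in no triangle of `G`. So the best free edge of `G` is also best among
  -- all free edges.
  D-outside : (x : Edge n → ℕ) (f : Edge n) → G f ≡ false → D x (at f) ≡ 0
  D-outside x f Gf = n≤0⇒n≡0 (begin
    D x (at f)                   ≤⟨ ∑³-mono pointwise ⟩
    ∑³ n (λ _ _ _ → 0 * 0)       ≡⟨ ∑³-distribˡ-* {n} 0 (λ _ _ _ → 0) ⟩
    0                            ∎)
    where
    open ≤-Reasoning
    at-inside : ∀ {e} → G e ≡ true → at f e ≡ 0
    at-inside {e} Ge with sameEdge e f in eq
    ... | false = refl
    ... | true with () ← trans (sym Ge) (trans (cong G (sameEdge⇒≡ e f eq)) Gf)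
    pointwise : ∀ i j l → ⟦ inside i j l ⟧ * ∂ x (at f) i j l ≤ 0
    pointwise i j l with i << j | j << l | G (i , j) in Gij | G (j , l) in Gjl | G (i , l) in Gil
    ... | false | _     | _     | _     | _     = z≤n
    ... | true  | false | _     | _     | _     = z≤n
    ... | true  | true  | false | _     | _     = z≤n
    ... | true  | true  | true  | false | _     = z≤n
    ... | true  | true  | true  | true  | false = z≤n
    ... | true  | true  | true  | true  | true
      rewrite at-inside Gij | at-inside Gjl | at-inside Gil = z≤n

  -- The gain from `e` is measured before the round, the cost of `f` after the claim of `e`;
  -- `D-at-≤` brings the cost back to the earlier weights for 12, and there it is at most the gain.
  round-loss : (C B : List (Edge n)) (e f : Edge n) → free C B e ≡ true → free (e ∷ C) B f ≡ true →
               D (weight C B) (at f) ≤ D (weight C B) (at e) →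
               Φ (weight C B) ≤ Φ (weight (e ∷ C) (f ∷ B)) + 12
  round-loss C B e f free-e free-f Df≤De = +-cancelʳ-≤ (D x (at e)) _ _ (begin
    Φ x + D x (at e)            ≤⟨ Φ-+-≥ x (at e) x′ (weight-claimC C B e free-e) ⟩
    Φ x′                        ≤⟨ Φ-+-≤ x″ (at f) x′ (weight-claimB (e ∷ C) B f free-f) ⟩
    Φ x″ + D x′ (at f)          ≤⟨ +-monoʳ-≤ (Φ x″) (D-at-≤ x x′ f e (weight-claimC C B e free-e) (weight≤2 (e ∷ C) B)) ⟩
    Φ x″ + (D x (at f) + 12)    ≤⟨ +-monoʳ-≤ (Φ x″) (+-monoˡ-≤ 12 Df≤De) ⟩
    Φ x″ + (D x (at e) + 12)    ≡⟨ cong (Φ x″ +_) (+-comm (D x (at e)) 12) ⟩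
    Φ x″ + (12 + D x (at e))    ≡⟨ +-assoc (Φ x″) 12 _ ⟨
    Φ x″ + 12 + D x (at e)      ∎)
    where
    open ≤-Reasoning
    x = weight C B
    x′ = weight (e ∷ C) B
    x″ = weight (e ∷ C) (f ∷ B)

  -- Every edge of `G` now has weight 0 or 2, so a triangle of `G` contributes 8 if Constructor owns
  -- all its edges and nothing otherwise.
  Φ-exhausted : (C B : List (Edge n)) → filterᵇ G (unclaimed C B) ≡ [] → Φ (weight C B) ≤ 8 * triangles C
  Φ-exhausted C B none = begin
    Φ (weight C B)              ≤⟨ ∑³-mono pointwise ⟩
    ∑³ n (λ i j l → 8 * triangle i j l)
                                ≡⟨ ∑³-distribˡ-* 8 triangle ⟩
    8 * ∑³ n triangle
                                ≡⟨ cong (8 *_) (triangles≡∑³ C) ⟨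
    8 * triangles C             ∎
    where
    open ≤-Reasoning
    triangle : Fin n → Fin n → Fin n → ℕ
    triangle i j l = ⟦ (i << j) ∧ (j << l) ∧ adj C i j ∧ adj C j l ∧ adj C i l ⟧
    claimed : ∀ {i j} → (i << j) ≡ true → G (i , j) ≡ true → weight C B (i , j) ≤ 2 * ⟦ adj C i j ⟧
    claimed {i} {j} i<<j Gij with (i , j) ∈ᵇ B in ∈B | (i , j) ∈ᵇ C in ∈C
    ... | true  | _     = z≤n
    ... | false | true  rewrite ∈ᵇ⇒adj C {i} {j} ∈C = ≤-refl
    ... | false | false
      with () ← subst ((i , j) ∈_) none
        (∈-filterᵇ⁺ (∈-filterᵇ⁺ (∈-allEdges i<<j) (cong not (cong₂ _∨_ ∈C ∈B))) Gij)
    -- The summand `+ 0` is left over from reducing the multiplication by the indicator 1.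
    2³ : ∀ a b c → 2 * ⟦ a ⟧ * (2 * ⟦ b ⟧) * (2 * ⟦ c ⟧) + 0 ≤ 8 * ⟦ a ∧ b ∧ c ⟧
    2³ false b     c     = z≤n
    2³ true  false c     = z≤n
    2³ true  true  false = z≤n
    2³ true  true  true  = ≤-refl
    pointwise : ∀ i j l → ⟦ inside i j l ⟧ * prod (weight C B) i j l ≤ 8 * triangle i j l
    pointwise i j l with i << j in i<<j | j << l in j<<l | G (i , j) in Gij | G (j , l) in Gjl | G (i , l) in Gil
    ... | false | _     | _     | _     | _     = z≤n
    ... | true  | false | _     | _     | _     = z≤n
    ... | true  | true  | false | _     | _     = z≤n
    ... | true  | true  | true  | false | _     = z≤n
    ... | true  | true  | true  | true  | false = z≤n
    ... | true  | true  | true  | true  | true  = ≤-trans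
      (+-monoˡ-≤ 0 (*-mono-≤ (*-mono-≤ (claimed i<<j Gij) (claimed j<<l Gjl))
        (claimed (<ᵇ-trans (toℕ i) (toℕ j) (toℕ l) i<<j j<<l) Gil)))
      (2³ (adj C i j) (adj C j l) (adj C i l))

  -- Legality of moves inside the graph

  -- An invariant of the play: Constructor turns a free edge of `G` at `a` into a claimed one, and
  -- Blocker can only lower the number of free ones.
  DegreeBound : (C B : List (Edge n)) → Set
  DegreeBound C B = ∀ a → deg C a + count (λ e → G e ∧ incident a e) C B ≤ k

  -- The edge `e` is itself a free edge of `G` at `a`, so the count in the invariant is at least 1.
  deg<k : (C B : List (Edge n)) {e : Edge n} → e ∈ allEdges n → free C B e ≡ true → G e ≡ true →
          DegreeBound C B → ∀ a → incident a e ≡ true → deg C a < k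
  deg<k C B {e} e∈ free-e Ge bound a inc-e = begin
    1 + deg C a          ≡⟨ +-comm 1 (deg C a) ⟩
    deg C a + 1          ≤⟨ +-monoʳ-≤ (deg C a) (≤-trans (m≤n+m 1 _)
                              (subst (λ b → count H (e ∷ C) B + ⟦ b ⟧ ≤ count H C B)
                                     (cong₂ _∧_ Ge inc-e) (count-claimC H C B e∈ free-e))) ⟩
    deg C a + count H C B  ≤⟨ bound a ⟩
    k                    ∎
    where
    open ≤-Reasoning
    H : Edge n → Bool
    H e = G e ∧ incident a e

  legal : (C B : List (Edge n)) {e : Edge n} → e ∈ allEdges n → free C B e ≡ true → G e ≡ true →
          DegreeBound C B → legalC k C e ≡ true
  legal C B {a , b} e∈ free-e Ge bound = cong₂ _∧_
    (Equivalence.to T-≡ (<⇒<ᵇ (deg<k C B e∈ free-e Ge bound a (cong (_∨ (b == a)) (≡ᵇ-refl (toℕ a))))))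
    (Equivalence.to T-≡ (<⇒<ᵇ (deg<k C B e∈ free-e Ge bound b (trans (cong ((a == b) ∨_) (≡ᵇ-refl (toℕ b))) (∨-zeroʳ (a == b))))))

  DegreeBound-round : (C B : List (Edge n)) {e f : Edge n} →
    e ∈ allEdges n → free C B e ≡ true → G e ≡ true →
    f ∈ allEdges n → free (e ∷ C) B f ≡ true →
    DegreeBound C B → DegreeBound (e ∷ C) (f ∷ B)
  DegreeBound-round C B {e} {f} e∈ free-e Ge f∈ free-f bound a = begin
    deg (e ∷ C) a + count H (e ∷ C) (f ∷ B)
      ≤⟨ +-monoʳ-≤ (deg (e ∷ C) a) (m+n≤o⇒m≤o _ (count-claimB H (e ∷ C) B f∈ free-f)) ⟩
    deg (e ∷ C) a + count H (e ∷ C) B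
      ≡⟨ cong (_+ count H (e ∷ C) B) (trans (deg-∷ e C a) (+-comm ⟦ incident a e ⟧ (deg C a))) ⟩
    deg C a + ⟦ incident a e ⟧ + count H (e ∷ C) B
      ≡⟨ +-assoc (deg C a) _ _ ⟩
    deg C a + (⟦ incident a e ⟧ + count H (e ∷ C) B)
      ≡⟨ cong (deg C a +_) (+-comm ⟦ incident a e ⟧ _) ⟩
    deg C a + (count H (e ∷ C) B + ⟦ incident a e ⟧)
      ≡⟨ cong (λ b → deg C a + (count H (e ∷ C) B + ⟦ b ∧ incident a e ⟧)) Ge ⟨
    deg C a + (count H (e ∷ C) B + ⟦ H e ⟧)
      ≤⟨ +-monoʳ-≤ (deg C a) (count-claimC H C B e∈ free-e) ⟩
    deg C a + count H C B
      ≤⟨ bound a ⟩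
    k ∎
    where
    open ≤-Reasoning
    H : Edge n → Bool
    H e = G e ∧ incident a e

  -- The greedy strategy and its score

  -- The comparison is with all free edges, inside `G` or not, since Blocker may reply with any of
  -- them.
  Greedy : (C B : List (Edge n)) → Edge n → Set
  Greedy C B e = ∀ f → f ∈ allEdges n → free C B f ≡ true → D (weight C B) (at f) ≤ D (weight C B) (at e)

  greedy-edge : (C B : List (Edge n)) {e₀ : Edge n} {es : List (Edge n)} → filterᵇ G (unclaimed C B) ≡ e₀ ∷ es →
                ∃[ e ] (e ∈ filterᵇ G (unclaimed C B) × Greedy C B e)
  greedy-edge C B {e₀} {es} eq = e , subst (e ∈_) (sym eq) e∈ , greedy
    where
    d : Edge n → ℕ
    d f = D (weight C B) (at f)
    e = argmax d e₀ es
    e∈ : e ∈ e₀ ∷ es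
    e∈ with argmax-sel d e₀ es
    ... | inj₁ e≡e₀ = here e≡e₀
    ... | inj₂ e∈es = there e∈es
    maximal : ∀ {f} → f ∈ e₀ ∷ es → d f ≤ d e
    maximal (here refl)  = f[⊥]≤f[argmax] {f = d} e₀ es
    maximal (there f∈es) = All.lookup (f[xs]≤f[argmax] {f = d} e₀ es) f∈es
    greedy : Greedy C B e
    greedy f f∈ free-f with G f in Gf
    ... | false rewrite D-outside (weight C B) f Gf = z≤n
    ... | true  = maximal (subst (f ∈_) eq (∈-filterᵇ⁺ (∈-filterᵇ⁺ f∈ free-f) Gf))

  free-before : (C B : List (Edge n)) (e f : Edge n) → free (e ∷ C) B f ≡ true → free C B f ≡ true
  free-before C B e f free-f with sameEdge f e
  ... | false = free-f

  -- Each round lowers `Φ` by at most 12 and uses up a free edge of `G`, so `12 * count G C B`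
  -- covers all losses to come. At Blocker's turn `Φ` is still taken before the claim of `e`,
  -- because the loss is controlled only over a whole round.
  valC-bound : ∀ fuel (C B : List (Edge n)) → count all C B ≤ fuel → DegreeBound C B →
               Φ (weight C B) ≤ 8 * valC k fuel C B + 12 * count G C B
  valB-bound : ∀ fuel (C B : List (Edge n)) {e} → count all C B ≤ suc fuel → DegreeBound C B →
               e ∈ allEdges n → free C B e ≡ true → G e ≡ true → Greedy C B e →
               Φ (weight C B) ≤ 8 * valB k fuel (e ∷ C) B + 12 * count G C B

  valC-bound fuel C B enough bound with filterᵇ G (unclaimed C B) in eq
  valC-bound fuel C B enough bound | [] = begin
    Φ (weight C B)                          ≤⟨ Φ-exhausted C B eq ⟩
    8 * triangles C                         ≤⟨ *-monoʳ-≤ 8 (triangles≤valC k fuel C B) ⟩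
    8 * valC k fuel C B                     ≤⟨ m≤m+n _ _ ⟩
    8 * valC k fuel C B + 12 * count G C B  ∎
    where open ≤-Reasoning
  -- Without fuel no edge is free, so `G` cannot have a free edge either.
  valC-bound zero C B enough bound | _ ∷ _
    with unclaimed C B | length-unclaimed C B
  ... | []    | _ with () ← eq
  ... | _ ∷ _ | len with () ← subst (_≤ 0) (sym len) enough
  valC-bound (suc fuel) C B enough bound | _ ∷ _
    with e , e∈G , greedy ← greedy-edge C B eq
    with e∈U , Ge ← ∈-filterᵇ⁻ {p = G} e∈G
    with e∈ , free-e ← ∈-filterᵇ⁻ {p = free C B} e∈U = begin
    Φ (weight C B)
      ≤⟨ valB-bound fuel C B enough bound e∈ free-e Ge greedy ⟩
    8 * valB k fuel (e ∷ C) B + 12 * count G C B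
      ≤⟨ +-monoˡ-≤ (12 * count G C B) (*-monoʳ-≤ 8 (valC-upper k fuel C B
           (∈-filterᵇ⁺ e∈U (legal C B e∈ free-e Ge bound)))) ⟩
    8 * valC k (suc fuel) C B + 12 * count G C B ∎
    where open ≤-Reasoning

  valB-bound fuel C B {e} enough bound e∈ free-e Ge greedy = go fuel enough
    where
    open ≤-Reasoning
    -- When Blocker has no reply, only the claim of `e` matters, and it cannot lower `Φ`.
    none-left : unclaimed (e ∷ C) B ≡ [] → Φ (weight C B) ≤ 8 * triangles (e ∷ C) + 12 * count G C B
    none-left none = begin
      Φ (weight C B)                                  ≤⟨ m+n≤o⇒m≤o _ (Φ-+-≥ (weight C B) (at e) (weight (e ∷ C) B) (weight-claimC C B e free-e)) ⟩
      Φ (weight (e ∷ C) B)                            ≤⟨ Φ-exhausted (e ∷ C) B (cong (filterᵇ G) none) ⟩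
      8 * triangles (e ∷ C)                           ≤⟨ m≤m+n _ _ ⟩
      8 * triangles (e ∷ C) + 12 * count G C B        ∎
    go : ∀ fuel → count all C B ≤ suc fuel →
         Φ (weight C B) ≤ 8 * valB k fuel (e ∷ C) B + 12 * count G C B
    -- Here at most one edge was free before the claim, so `e` was the last one.
    go zero enough = none-left (length≡0 (unclaimed (e ∷ C) B) (n≤0⇒n≡0 (+-cancelʳ-≤ 1 _ 0 (begin
      length (unclaimed (e ∷ C) B) + 1  ≡⟨ cong (_+ 1) (length-unclaimed (e ∷ C) B) ⟩
      count all (e ∷ C) B + 1           ≤⟨ count-claimC all C B e∈ free-e ⟩
      count all C B                     ≤⟨ enough ⟩
      1                                 ∎))))
      where
      length≡0 : {A : Set} (xs : List A) → length xs ≡ 0 → xs ≡ []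
      length≡0 [] _ = refl
    go (suc fuel) enough =
      valB-preserves (λ v → Φ (weight C B) ≤ 8 * v + 12 * count G C B) k fuel (e ∷ C) B none-left move
      where
      move : ∀ {f} → f ∈ unclaimed (e ∷ C) B →
             Φ (weight C B) ≤ 8 * valC k fuel (e ∷ C) (f ∷ B) + 12 * count G C B
      move {f} f∈U with f∈ , free-f ← ∈-filterᵇ⁻ {p = free (e ∷ C) B} f∈U = begin
        Φ (weight C B)
          ≤⟨ round-loss C B e f free-e free-f (greedy f f∈ (free-before C B e f free-f)) ⟩
        Φ (weight (e ∷ C) (f ∷ B)) + 12
          ≤⟨ +-monoˡ-≤ 12 (valC-bound fuel (e ∷ C) (f ∷ B) enough′
               (DegreeBound-round C B e∈ free-e Ge f∈ free-f bound)) ⟩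
        8 * v + 12 * u + 12
          ≡⟨ +-assoc (8 * v) (12 * u) 12 ⟩
        8 * v + (12 * u + 12 * 1)
          ≡⟨ cong (8 * v +_) (*-distribˡ-+ 12 u 1) ⟨
        8 * v + 12 * (u + 1)
          ≤⟨ +-monoʳ-≤ (8 * v) (*-monoʳ-≤ 12 u+1≤) ⟩
        8 * v + 12 * count G C B ∎
        where
        v = valC k fuel (e ∷ C) (f ∷ B)
        u = count G (e ∷ C) (f ∷ B)
        -- The drop by one is due to Constructor's edge; the reply can only lower the count further.
        u+1≤ : u + 1 ≤ count G C B
        u+1≤ = ≤-trans (+-monoˡ-≤ 1 (m+n≤o⇒m≤o _ (count-claimB G (e ∷ C) B f∈ free-f)))
                       (subst (λ b → count G (e ∷ C) B + ⟦ b ⟧ ≤ count G C B) Ge (count-claimC G C B e∈ free-e))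
        enough′ : count all (e ∷ C) (f ∷ B) ≤ fuel
        -- A round uses two free edges and two units of fuel.
        enough′ = +-cancelʳ-≤ 2 _ _ (begin
          count all (e ∷ C) (f ∷ B) + 2      ≡⟨ +-assoc (count all (e ∷ C) (f ∷ B)) 1 1 ⟨
          count all (e ∷ C) (f ∷ B) + 1 + 1  ≤⟨ +-monoˡ-≤ 1 (count-claimB all (e ∷ C) B f∈ free-f) ⟩
          count all (e ∷ C) B + 1            ≤⟨ count-claimC all C B e∈ free-e ⟩
          count all C B                      ≤⟨ enough ⟩
          2 + fuel                           ≡⟨ +-comm 2 fuel ⟩
          fuel + 2                           ∎)

  -- At the start all weights are 1, so `Φ` is the number of triangles of `G`, and all edges of `G`
  -- are free.
  game-bound : (∀ a → ∑ (allEdges n) (λ e → ⟦ G e ∧ incident a e ⟧) ≤ k) →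
               ∑³ n (λ i j l → ⟦ inside i j l ⟧) ≤
               8 * g-K3-star n k + 12 * ∑ (allEdges n) (λ e → ⟦ G e ⟧)
  game-bound max-degree = begin
    ∑³ n (λ i j l → ⟦ inside i j l ⟧)
      ≤⟨ ∑³-mono (λ i j l → ≤-reflexive (sym (*-identityʳ ⟦ inside i j l ⟧))) ⟩
    Φ (weight [] [])
      ≤⟨ valC-bound (length (allEdges n)) [] []
           (subst (_≤ length (allEdges n)) (length-unclaimed {n} [] []) (length-filter _ (allEdges n)))
           (λ a → subst (_≤ k) (sym (count-[] (λ e → G e ∧ incident a e))) (max-degree a)) ⟩
    8 * g-K3-star n k + 12 * count G [] []
      ≡⟨ cong (λ c → 8 * g-K3-star n k + 12 * c) (count-[] G) ⟩
    8 * g-K3-star n k + 12 * ∑ (allEdges n) (λ e → ⟦ G e ⟧) ∎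
    where
    open ≤-Reasoning
    count-[] : (H : Edge n → Bool) → count H [] [] ≡ ∑ (allEdges n) (λ e → ⟦ H e ⟧)
    count-[] H = ∑-cong (allEdges n) λ e → cong ⟦_⟧ (∧-identityʳ (H e))

-- Counting pairs and triples

-- Together with `triples`, the binomial coefficients k choose 2 and k choose 3, kept as sums so
-- that `triples` matches the count of triangles within a block.
pairs : ℕ → ℕ
pairs k = ∑< k λ j → ∑< k λ l → ⟦ j <ᵇ l ⟧

triples : ℕ → ℕ
triples k = ∑< k λ i → ∑< k λ j → ∑< k λ l → ⟦ (i <ᵇ j) ∧ (j <ᵇ l) ⟧

∑<-const : ∀ n c → ∑< n (λ _ → c) ≡ n * c
∑<-const zero    c = refl
∑<-const (suc n) c = cong (c +_) (∑<-const n c)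

-- There are `k` pairs with least element 0; the others are the pairs below `k` shifted by one.
-- `triples-suc` splits in the same way.
pairs-suc : ∀ k → k + pairs k ≤ pairs (suc k)
pairs-suc k = +-monoˡ-≤ (pairs k) (≤-reflexive (sym (trans (∑<-const k 1) (*-identityʳ k))))

k²≤2*pairs+k : ∀ k → k * k ≤ 2 * pairs k + k
k²≤2*pairs+k zero    = z≤n
k²≤2*pairs+k (suc k) = begin
  suc k * suc k                    ≡⟨ square k ⟩
  k * k + (2 * k + 1)              ≤⟨ +-monoˡ-≤ (2 * k + 1) (k²≤2*pairs+k k) ⟩
  2 * pairs k + k + (2 * k + 1)    ≡⟨ regroup (pairs k) k ⟩
  2 * (k + pairs k) + suc k        ≤⟨ +-monoˡ-≤ (suc k) (*-monoʳ-≤ 2 (pairs-suc k)) ⟩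
  2 * pairs (suc k) + suc k        ∎
  where
  open ≤-Reasoning
  open +-*-Solver
  square : ∀ k → suc k * suc k ≡ k * k + (2 * k + 1)
  square = solve 1 (λ k → (con 1 :+ k) :* (con 1 :+ k) := k :* k :+ (con 2 :* k :+ con 1)) refl
  regroup : ∀ p k → 2 * p + k + (2 * k + 1) ≡ 2 * (k + p) + suc k
  regroup = solve 2 (λ p k → con 2 :* p :+ k :+ (con 2 :* k :+ con 1) := con 2 :* (k :+ p) :+ (con 1 :+ k)) refl

triples-suc : ∀ k → pairs k + triples k ≤ triples (suc k)
triples-suc k = +-mono-≤ (m≤n+m (pairs k) _)
  (∑<-mono k λ i _ → ≤-trans (∑<-mono k λ j _ → m≤n+m _ _) (m≤n+m _ _))

-- Six times k choose 3 is k³ - 3k² + 2k. The term 2k is given away, which accounts for the slack of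
-- 2 in the inductive step.
k³≤6*triples+3k² : ∀ k → k * (k * k) ≤ 6 * triples k + 3 * (k * k)
k³≤6*triples+3k² zero    = z≤n
k³≤6*triples+3k² (suc k) = begin
  suc k * (suc k * suc k)
    ≡⟨ cube k ⟩
  k * (k * k) + (3 * (k * k) + (3 * k + 1))
    ≤⟨ +-mono-≤ (k³≤6*triples+3k² k) (+-monoˡ-≤ (3 * k + 1) (*-monoʳ-≤ 3 (k²≤2*pairs+k k))) ⟩
  6 * triples k + 3 * (k * k) + (3 * (2 * pairs k + k) + (3 * k + 1))
    ≤⟨ m≤m+n _ 2 ⟩
  6 * triples k + 3 * (k * k) + (3 * (2 * pairs k + k) + (3 * k + 1)) + 2
    ≡⟨ regroup (triples k) (pairs k) k ⟩
  6 * (pairs k + triples k) + 3 * (suc k * suc k)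
    ≤⟨ +-monoˡ-≤ _ (*-monoʳ-≤ 6 (triples-suc k)) ⟩
  6 * triples (suc k) + 3 * (suc k * suc k) ∎
  where
  open ≤-Reasoning
  open +-*-Solver
  cube : ∀ k → suc k * (suc k * suc k) ≡ k * (k * k) + (3 * (k * k) + (3 * k + 1))
  cube = solve 1 (λ k → (con 1 :+ k) :* ((con 1 :+ k) :* (con 1 :+ k))
    := k :* (k :* k) :+ (con 3 :* (k :* k) :+ (con 3 :* k :+ con 1))) refl
  regroup : ∀ t p k → 6 * t + 3 * (k * k) + (3 * (2 * p + k) + (3 * k + 1)) + 2 ≡
                      6 * (p + t) + 3 * (suc k * suc k)
  regroup = solve 3 (λ t p k →
    con 6 :* t :+ con 3 :* (k :* k) :+ (con 3 :* (con 2 :* p :+ k) :+ (con 3 :* k :+ con 1)) :+ con 2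
    := con 6 :* (p :+ t) :+ con 3 :* ((con 1 :+ k) :* (con 1 :+ k))) refl

-- Counting over intervals and blocks

-- Removing the index 0 slides the interval down by one; once it starts at 0, each removed index
-- uses up one of its `k` places.
∑<-within : ∀ n lo k (p : ℕ → Bool) → (∀ j → p j ≡ true → lo ≤ j × j < lo + k) →
            ∑< n (λ j → ⟦ p j ⟧) ≤ k
∑<-within zero    lo       k p within = z≤n
∑<-within (suc n) (suc lo) k p within with p 0 in p0
... | true  with () ← proj₁ (within 0 p0)
... | false = ∑<-within n lo k (λ j → p (suc j)) λ j pj →
  s≤s⁻¹ (proj₁ (within (suc j) pj)) , s≤s⁻¹ (proj₂ (within (suc j) pj))
∑<-within (suc n) zero zero p within with p 0 in p0
... | true  with () ← proj₂ (within 0 p0)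
... | false = ∑<-within n zero zero (λ j → p (suc j)) λ j pj →
  contradiction (proj₂ (within (suc j) pj)) (λ ())
∑<-within (suc n) zero (suc k) p within =
  +-mono-≤ (⟦⟧≤1 (p 0)) (∑<-within n zero k (λ j → p (suc j)) λ j pj → z≤n , s≤s⁻¹ (proj₂ (within (suc j) pj)))

<ᵇ-shift : ∀ m a b → (m + a <ᵇ m + b) ≡ (a <ᵇ b)
<ᵇ-shift zero    a b = refl
<ᵇ-shift (suc m) a b = <ᵇ-shift m a b

-- The induction removes the last block, so that the offsets of the others stay as they are.
∑<-blocks : ∀ q k {c} (f : ℕ → ℕ) → (∀ b → b < q → c ≤ ∑< k (λ r → f (b * k + r))) → q * c ≤ ∑< (q * k) f
∑<-blocks zero    k     f c≤ = z≤n
∑<-blocks (suc q) k {c} f c≤ = begin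
  c + q * c                                       ≡⟨ +-comm c (q * c) ⟩
  q * c + c                                       ≤⟨ +-mono-≤ (∑<-blocks q k f λ b b<q → c≤ b (m<n⇒m<1+n b<q)) (c≤ q ≤-refl) ⟩
  ∑< (q * k) f + ∑< k (λ r → f (q * k + r))       ≡⟨ ∑<-+ (q * k) k f ⟨
  ∑< (q * k + k) f                                ≡⟨ cong (λ m → ∑< m f) (+-comm (q * k) k) ⟩
  ∑< (suc q * k) f                                ∎
  where open ≤-Reasoning

-- The union of cliques on the blocks

module Blocks (n k : ℕ) .{{_ : NonZero k}} where

  sameBlock : Edge n → Bool
  sameBlock (i , j) = toℕ i / k ≡ᵇ toℕ j / k

  open Board k sameBlock using (inside; game-bound)

  quotient-of-block : ∀ b {r} → r < k → (b * k + r) / k ≡ b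
  quotient-of-block b {r} r<k = begin
    (b * k + r) / k    ≡⟨ +-distrib-/-∣ˡ r (n∣m*n b) ⟩
    b * k / k + r / k  ≡⟨ cong₂ _+_ (m*n/n≡m b k) (m<n⇒m/n≡0 r<k) ⟩
    b + 0              ≡⟨ +-identityʳ b ⟩
    b                  ∎
    where open ≡-Reasoning

  block-size : ∀ c → ∑ (allFin n) (λ j → ⟦ c ≡ᵇ toℕ j / k ⟧) ≤ k
  block-size c = subst (_≤ k) (sym (∑-allFin n (λ j → ⟦ c ≡ᵇ j / k ⟧)))
    (∑<-within n (c * k) k (λ j → c ≡ᵇ j / k) within)
    where
    within : ∀ j → (c ≡ᵇ j / k) ≡ true → c * k ≤ j × j < c * k + k
    within j c≡ᵇj/k rewrite ≡ᵇ⇒≡ c (j / k) (Equivalence.from T-≡ c≡ᵇj/k) =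
      m/n*n≤m j k , (begin-strict
        j                    ≡⟨ m≡m%n+[m/n]*n j k ⟩
        j % k + j / k * k    <⟨ +-monoˡ-< (j / k * k) (m%n<n j k) ⟩
        k + j / k * k        ≡⟨ +-comm k _ ⟩
        j / k * k + k        ∎)
      where open ≤-Reasoning

  -- An edge at `a` has `a` as its smaller or its larger end. Either way the other end lies in the
  -- block of `a`, and it cannot occur in both roles.
  degree-≤ : ∀ a → ∑ (allEdges n) (λ e → ⟦ sameBlock e ∧ incident a e ⟧) ≤ k
  degree-≤ a = begin
    ∑ (allEdges n) (λ e → ⟦ sameBlock e ∧ incident a e ⟧)
      ≡⟨ ∑-allEdges (λ e → ⟦ sameBlock e ∧ incident a e ⟧) ⟩
    (∑ F λ i → ∑ F λ j → ⟦ i << j ⟧ * ⟦ sameBlock (i , j) ∧ incident a (i , j) ⟧)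
      ≤⟨ ∑-mono F (λ i → ∑-mono F λ j → split (i << j) (sameBlock (i , j)) (i == a) (j == a)) ⟩
    (∑ F λ i → ∑ F λ j → ⟦ i == a ⟧ * h i j + ⟦ j == a ⟧ * h i j)
      ≡⟨ ∑-cong F (λ i → trans (∑-distrib-+ F (λ j → ⟦ i == a ⟧ * h i j) (λ j → ⟦ j == a ⟧ * h i j))
           (cong (_+ ∑ F (λ j → ⟦ j == a ⟧ * h i j)) (∑-distribˡ-* F ⟦ i == a ⟧ (h i)))) ⟩
    (∑ F λ i → ⟦ i == a ⟧ * ∑ F (h i) + ∑ F λ j → ⟦ j == a ⟧ * h i j)
      ≡⟨ ∑-distrib-+ F (λ i → ⟦ i == a ⟧ * ∑ F (h i)) (λ i → ∑ F λ j → ⟦ j == a ⟧ * h i j) ⟩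
    (∑ F λ i → ⟦ i == a ⟧ * ∑ F (h i)) + (∑ F λ i → ∑ F λ j → ⟦ j == a ⟧ * h i j)
      ≤⟨ +-mono-≤ (∑-δ a (λ i → ∑ F (h i))) (∑-mono F λ i → ∑-δ a (h i)) ⟩
    ∑ F (h a) + ∑ F (λ i → h i a)
      ≡⟨ ∑-distrib-+ F (h a) (λ i → h i a) ⟨
    ∑ F (λ i → h a i + h i a)
      ≤⟨ ∑-mono F one-direction ⟩
    ∑ F (λ i → ⟦ toℕ a / k ≡ᵇ toℕ i / k ⟧)
      ≤⟨ block-size (toℕ a / k) ⟩
    k ∎
    where
    open ≤-Reasoning
    F = allFin n
    h : Fin n → Fin n → ℕ
    h i j = ⟦ (i << j) ∧ sameBlock (i , j) ⟧
    split : ∀ a b c d → ⟦ a ⟧ * ⟦ b ∧ (c ∨ d) ⟧ ≤ ⟦ c ⟧ * ⟦ a ∧ b ⟧ + ⟦ d ⟧ * ⟦ a ∧ b ⟧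
    split false b     c     d     = z≤n
    split true  false c     d     = z≤n
    split true  true  true  d     = s≤s z≤n
    split true  true  false true  = ≤-refl
    split true  true  false false = z≤n
    one-direction : ∀ i → h a i + h i a ≤ ⟦ toℕ a / k ≡ᵇ toℕ i / k ⟧
    one-direction i with a << i in a<<i | i << a in i<<a
    ... | false | false = z≤n
    ... | true  | false = ≤-reflexive (+-identityʳ _)
    ... | false | true  = ⟦⟧-mono λ eq → Equivalence.to T-≡ (≡⇒≡ᵇ (toℕ a / k) (toℕ i / k)
      (sym (≡ᵇ⇒≡ (toℕ i / k) (toℕ a / k) (Equivalence.from T-≡ eq))))
    ... | true  | true  = contradiction
      (<-trans (<ᵇ⇒< (toℕ a) (toℕ i) (Equivalence.from T-≡ a<<i)) (<ᵇ⇒< (toℕ i) (toℕ a) (Equivalence.from T-≡ i<<a)))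
      (<-irrefl refl)

  edges-≤ : ∑ (allEdges n) (λ e → ⟦ sameBlock e ⟧) ≤ n * k
  edges-≤ = begin
    ∑ (allEdges n) (λ e → ⟦ sameBlock e ⟧)
      ≡⟨ ∑-allEdges (λ e → ⟦ sameBlock e ⟧) ⟩
    (∑ (allFin n) λ i → ∑ (allFin n) λ j → ⟦ i << j ⟧ * ⟦ sameBlock (i , j) ⟧)
      ≤⟨ ∑-mono (allFin n) (λ i → ∑-mono (allFin n) λ j → *-monoˡ-≤ ⟦ sameBlock (i , j) ⟧ (⟦⟧≤1 (i << j))) ⟩
    (∑ (allFin n) λ i → ∑ (allFin n) λ j → 1 * ⟦ sameBlock (i , j) ⟧)
      ≤⟨ ∑-mono (allFin n) (λ i → ≤-trans (≤-reflexive (∑-cong (allFin n) λ j → *-identityˡ _)) (block-size (toℕ i / k))) ⟩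
    ∑ (allFin n) (λ _ → k)
      ≡⟨ trans (∑-allFin n (λ _ → k)) (∑<-const n k) ⟩
    n * k ∎
    where open ≤-Reasoning

  -- Only the `n / k` full blocks are counted; translation by `b * k` carries the triples below `k`
  -- to triangles in block `b`.
  triples-≤ : n / k * triples k ≤ ∑³ n (λ i j l → ⟦ inside i j l ⟧)
  triples-≤ = begin
    n / k * triples k
      ≤⟨ ∑<-blocks (n / k) k (λ i → ∑< n λ j → ∑< n λ l → t i j l) in-block ⟩
    ∑< (n / k * k) (λ i → ∑< n λ j → ∑< n λ l → t i j l)
      ≤⟨ ∑<-interval 0 (n / k * k) _ (m/n*n≤m n k) ⟩
    ∑< n (λ i → ∑< n λ j → ∑< n λ l → t i j l)
      ≡⟨ trans (∑-cong (allFin n) (λ i → trans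
           (∑-cong (allFin n) (λ j → ∑-allFin n (t (toℕ i) (toℕ j))))
           (∑-allFin n (λ j → ∑< n (t (toℕ i) j)))))
         (∑-allFin n (λ i → ∑< n λ j → ∑< n (t i j))) ⟨
    ∑³ n (λ i j l → ⟦ inside i j l ⟧) ∎
    where
    open ≤-Reasoning
    t : ℕ → ℕ → ℕ → ℕ
    t i j l = ⟦ (i <ᵇ j) ∧ (j <ᵇ l) ∧ (i / k ≡ᵇ j / k) ∧ (j / k ≡ᵇ l / k) ∧ (i / k ≡ᵇ l / k) ⟧
    shifted : ∀ b r s u → r < k → s < k → u < k →
              ⟦ (r <ᵇ s) ∧ (s <ᵇ u) ⟧ ≤ t (b * k + r) (b * k + s) (b * k + u)
    shifted b r s u r<k s<k u<k
      rewrite quotient-of-block b r<k | quotient-of-block b s<k | quotient-of-block b u<k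
            | ≡ᵇ-refl b | <ᵇ-shift (b * k) r s | <ᵇ-shift (b * k) s u
      = ≤-reflexive (cong (λ c → ⟦ (r <ᵇ s) ∧ c ⟧) (sym (∧-identityʳ (s <ᵇ u))))
    in-block : ∀ b → b < n / k → triples k ≤ ∑< k (λ r → ∑< n λ j → ∑< n λ l → t (b * k + r) j l)
    in-block b b<q = ∑<-mono k λ r r<k → ≤-trans
      (∑<-mono k λ s s<k → ≤-trans
        (∑<-mono k λ u u<k → shifted b r s u r<k s<k u<k)
        (∑<-interval (b * k) k (t (b * k + r) (b * k + s)) fits))
      (∑<-interval (b * k) k (λ j → ∑< n (t (b * k + r) j)) fits)
      where
      fits : b * k + k ≤ n
      fits = begin
        b * k + k    ≡⟨ +-comm (b * k) k ⟩
        suc b * k    ≤⟨ *-monoˡ-≤ k b<q ⟩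
        n / k * k    ≤⟨ m/n*n≤m n k ⟩
        n            ∎

  -- Here 48 = 6 · 8, for k choose 3 and for the weight of a surviving triangle, and 76 = 6 · 12 + 3
  -- + 1, for the losses in play, the lower-order part of k choose 3, and the incomplete block.
  score-≥ : k * k ≤ n → n * (k * k) ≤ 48 * g-K3-star n k + 76 * (n * k)
  score-≥ k²≤n = begin
    n * (k * k)
      ≤⟨ *-monoˡ-≤ (k * k) n≤qk+k ⟩
    (q * k + k) * (k * k)
      ≡⟨ expand q k ⟩
    q * (k * (k * k)) + k * (k * k)
      -- The share `k * (k * k)` of the incomplete block is at most `k * n`.
      ≤⟨ +-mono-≤ (*-monoʳ-≤ q (k³≤6*triples+3k² k)) (*-monoʳ-≤ k k²≤n) ⟩
    q * (6 * triples k + 3 * (k * k)) + k * n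
      ≡⟨ regroup q (triples k) k n ⟩
    6 * (q * triples k) + (3 * (q * k * k) + n * k)
      ≤⟨ +-mono-≤ (*-monoʳ-≤ 6 (≤-trans triples-≤ (≤-trans (game-bound degree-≤)
                    (+-monoʳ-≤ (8 * v) (*-monoʳ-≤ 12 edges-≤)))))
                  (+-monoˡ-≤ (n * k) (*-monoʳ-≤ 3 (*-monoˡ-≤ k (m/n*n≤m n k)))) ⟩
    6 * (8 * v + 12 * (n * k)) + (3 * (n * k) + n * k)
      ≡⟨ collect v (n * k) ⟩
    48 * v + 76 * (n * k) ∎
    where
    open ≤-Reasoning
    q = n / k
    v = g-K3-star n k
    n≤qk+k : n ≤ q * k + k
    n≤qk+k = begin
      n                  ≡⟨ m≡m%n+[m/n]*n n k ⟩
      n % k + q * k      ≤⟨ +-monoˡ-≤ (q * k) (m%n≤n n k) ⟩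
      k + q * k          ≡⟨ +-comm k (q * k) ⟩
      q * k + k          ∎
    expand : ∀ q k → (q * k + k) * (k * k) ≡ q * (k * (k * k)) + k * (k * k)
    expand = solve 2 (λ q k → (q :* k :+ k) :* (k :* k) := q :* (k :* (k :* k)) :+ k :* (k :* k)) refl
      where open +-*-Solver
    regroup : ∀ q t k n → q * (6 * t + 3 * (k * k)) + k * n ≡ 6 * (q * t) + (3 * (q * k * k) + n * k)
    regroup = solve 4 (λ q t k n → q :* (con 6 :* t :+ con 3 :* (k :* k)) :+ k :* n
      := con 6 :* (q :* t) :+ (con 3 :* (q :* k :* k) :+ n :* k)) refl
      where open +-*-Solver
    collect : ∀ v m → 6 * (8 * v + 12 * m) + (3 * m + m) ≡ 48 * v + 76 * m
    collect = solve 2 (λ v m → con 6 :* (con 8 :* v :+ con 12 :* m) :+ (con 3 :* m :+ m)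
      := con 48 :* v :+ con 76 :* m) refl
      where open +-*-Solver

-- The asymptotic statement

-- The factor 1 + o(1) is expressed by the fractions d / (d + 1): for each `d` the score is
-- eventually at least that fraction of n k² / 48. Likewise k = o(√n) reads: for each `d`,
-- eventually (d + 1) k² ≤ n.
theorem1p5 : (k : ℕ → ℕ)
    → (∀ M → ∃[ N ] (∀ n → N ≤ n → M ≤ k n))
    → (∀ d → ∃[ N ] (∀ n → N ≤ n → suc d * (k n * k n) ≤ n))
    → ∀ d → ∃[ N ] (∀ n → N ≤ n →
    d * (n * (k n * k n)) ≤ 48 * (suc d * g-K3-star n (k n)))
theorem1p5 k k→∞ k²=o[n] d
  -- With this threshold the error term, multiplied by `suc d`, is at most n k².
  with N₁ , large ← k→∞ (suc d * 76)
  with N₂ , k²≤n ← k²=o[n] 0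
  = N₁ ⊔ N₂ , λ n N≤n → bound n (k n) (large n (m⊔n≤o⇒m≤o N₁ N₂ N≤n))
      (≤-trans (≤-reflexive (sym (*-identityˡ _))) (k²≤n n (m⊔n≤o⇒n≤o N₁ N₂ N≤n)))
  where
  bound : ∀ n k → suc d * 76 ≤ k → k * k ≤ n → d * (n * (k * k)) ≤ 48 * (suc d * g-K3-star n k)
  -- The threshold is positive, which rules out `k = 0`. Adding n k² to both sides turns the factor
  -- `d` into `suc d`.
  bound n k@(suc _) 76d≤k k²≤n = +-cancelˡ-≤ (n * (k * k)) _ _ (begin
    suc d * (n * (k * k))
      ≤⟨ *-monoʳ-≤ (suc d) (Blocks.score-≥ n k k²≤n) ⟩
    suc d * (48 * v + 76 * (n * k))
      ≡⟨ regroup (suc d) v n k ⟩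
    n * (suc d * 76 * k) + 48 * (suc d * v)
      ≤⟨ +-monoˡ-≤ (48 * (suc d * v)) (*-monoʳ-≤ n (*-monoˡ-≤ k 76d≤k)) ⟩
    n * (k * k) + 48 * (suc d * v) ∎)
    where
    open ≤-Reasoning
    v = g-K3-star n k
    regroup : ∀ d v n k → d * (48 * v + 76 * (n * k)) ≡ n * (d * 76 * k) + 48 * (d * v)
    regroup = solve 4 (λ d v n k → d :* (con 48 :* v :+ con 76 :* (n :* k))
      := n :* (d :* con 76 :* k) :+ con 48 :* (d :* v)) refl
      where open +-*-Solver
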